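{- There exists an infinite maximal triangle-free graph which satisfies property $\mathscr{D}_k$ for every $k\ge1$ but which is not a blow-up of any finite graph.
   Context: A (possibly infinite) graph is maximal triangle-free if it contains no triangle but adding any new edge between non-adjacent vertices creates a triangle. Property $\mathscr{D}_k$: for every $m\in\{1,\dots,k\}$ and every sequence $x_1,\dots,x_{3m}$ of (not necessarily distinct) vertices there is a vertex $y$ with $|\{i\in[3m]: x_iy\in E(G)\}|\ge m+1$. A blow-up of $H$ is any graph obtained by replacing each vertex of $H$ by a non-empty independent set (possibly infinite) and each edge of $H$ by the complete bipartite graph between the corresponding sets, with no further edges. -}

module Defs where

open import Data.Fin using (Fin)
open import Data.Fin.Subset using (Subset; _∈_; ∣_∣)
open import Data.Nat using (ℕ; suc; _*_; _≤_)
open import Data.Product using (Σ; Σ-syntax; ∃-syntax; _×_; _,_; proj₁)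
open import Data.Sum using (_⊎_; inj₁; inj₂)
open import Function.Bundles using (_↔_; _⇔_; Inverse)
open import Relation.Binary.Definitions using (Symmetric)
open import Relation.Binary.PropositionalEquality using (_≡_; _≢_; sym; trans)
open import Relation.Nullary using (¬_)

record Graph : Set₁ where
  field
    V      : Set
    Adj    : V → V → Set
    symm   : Symmetric Adj
    irrefl : ∀ x → ¬ Adj x x

open Graph public

Finite : Set → Set
Finite A = ∃[ n ] (A ↔ Fin n)

Infinite : Set → Set
Infinite A = ¬ Finite A

-- The three vertices are automatically distinct, by irreflexivity.
HasTriangle : Graph → Set
HasTriangle G = ∃[ x ] ∃[ y ] ∃[ z ] (Adj G x y × Adj G y z × Adj G z x)

addEdge : (G : Graph) (x y : V G) → x ≢ y → Graph
addEdge G x y x≢y = record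
  { V      = V G
  ; Adj    = λ u v → Adj G u v ⊎ (u ≡ x × v ≡ y) ⊎ (u ≡ y × v ≡ x)
  ; symm   = λ { (inj₁ a)               → inj₁ (symm G a)
               ; (inj₂ (inj₁ (p , q))) → inj₂ (inj₂ (q , p))
               ; (inj₂ (inj₂ (p , q))) → inj₂ (inj₁ (q , p)) }
  ; irrefl = λ { u (inj₁ a)               → irrefl G u a
               ; u (inj₂ (inj₁ (p , q))) → x≢y (trans (sym p) q)
               ; u (inj₂ (inj₂ (p , q))) → x≢y (trans (sym q) p) }
  }

MaximalTriangleFree : Graph → Set
MaximalTriangleFree G =
  ¬ HasTriangle G ×
  (∀ x y (x≢y : x ≢ y) → ¬ Adj G x y → HasTriangle (addEdge G x y x≢y))

-- Adjacency is not assumed decidable, so the index set { i : x i ~ y } is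
-- given as the subset S characterised by its membership condition.
𝒟 : ℕ → Graph → Set
𝒟 k G = ∀ m → 1 ≤ m → m ≤ k → (x : Fin (3 * m) → V G) →
  ∃[ y ] Σ[ S ∈ Subset (3 * m) ]
    ((∀ i → (i ∈ S) ⇔ Adj G (x i) y) × suc m ≤ ∣ S ∣)

blowUp : (H : Graph) → (V H → Set) → Graph
blowUp H B = record
  { V      = Σ (V H) B
  ; Adj    = λ p q → Adj H (proj₁ p) (proj₁ q)
  ; symm   = symm H
  ; irrefl = λ p → irrefl H (proj₁ p)
  }

record _≅_ (G H : Graph) : Set where
  field
    bij     : V G ↔ V H
    adj-iff : ∀ x y → Adj G x y ⇔ Adj H (Inverse.to bij x) (Inverse.to bij y)

IsBlowUpOf : Graph → Graph → Set₁
IsBlowUpOf G H = Σ[ B ∈ (V H → Set) ] ((∀ v → B v) × G ≅ blowUp H B)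

{-# OPTIONS --safe #-}

-- The infinite Andrásfai graph: the Cayley graph of ℤ with respect to the
-- integers d with ∣ d ∣ ≡ 1 (mod 3). The sum of two such integers
-- has absolute value ≡ 0 or 2 (mod 3), so there is no triangle.
-- Conversely the neighbourhoods of c, c − 1 and c + 1 cover ℤ, and c itself is
-- covered twice. Hence a non-neighbour of c has a common neighbour with it, and
-- among 3m vertices containing c the three neighbourhoods catch at least 3m + 1
-- in total, so that one of them catches m + 1. Distinct multiples of 3 have
-- different neighbourhoods, whereas a blow-up of a graph on n vertices has
-- at most n different neighbourhoods.

module Submission where

open import Data.Fin using (Fin; zero; toℕ)
import Data.Fin as Fin
open import Data.Fin.Properties using (pigeonhole)
open import Data.Fin.Subset using (Subset; _∈_; ∣_∣; _∪_; _-_; ⊤; inside; outside)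
open import Data.Fin.Subset.Properties
  using (p⊆q⇒∣p∣≤∣q∣; ∣⊤∣≡n; x∈p∪q⁺; x∈p∧x≢y⇒x∈p-y; x∈p⇒∣p-x∣<∣p∣)
open import Data.Integer as ℤ using (ℤ; +_; -[1+_]; _⊖_)
import Data.Integer.Properties as ℤ
open import Data.Integer.Tactic.RingSolver using (solve-∀)
open import Data.Nat using (ℕ; zero; suc; _+_; _*_; _%_; _≤_; _<_; z≤n; s≤s; _≤?_; _≟_)
open import Data.Nat.DivMod using (%-distribˡ-+)
open import Data.Nat.Properties
  using (≤-trans; ≤-reflexive; ≰⇒>; <⇒≱; n<1+n; n≤1+n; +-suc; +-comm; +-identityʳ;
         +-mono-≤; +-monoʳ-≤; +-monoʳ-<; module ≤-Reasoning)
open import Data.Product using (Σ-syntax; ∃-syntax; ∃₂; _×_; _,_; proj₁; proj₂)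
open import Data.Sum using (_⊎_; inj₁; inj₂; map; map₂)
import Data.Unit as Unit
open import Data.Vec using (tabulate; []; _∷_)
open import Data.Vec.Properties using (lookup⇒[]=; []=⇒lookup; lookup∘tabulate)
open import Function using (_∘_; id)
open import Function.Bundles using (_⇔_; mk⇔; mk↔ₛ′; Inverse; Injection; Equivalence)
open import Function.Properties.Inverse using (↔⇒↣)
open import Relation.Binary.Definitions using () renaming (Decidable to Decidable₂)
open import Relation.Binary.PropositionalEquality
  using (_≡_; _≢_; refl; sym; trans; cong; cong₂; subst)
open import Relation.Nullary using (¬_; yes; no; does; contradiction)
open import Relation.Nullary.Decidable using (dec-true)
open import Relation.Unary using (Decidable)
open import Defs

-- Counting in finite subsets.

module _ {n p} {P : Fin n → Set p} (P? : Decidable P) where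

  select : Subset n
  select = tabulate (does ∘ P?)

  ∈-select : ∀ i → (i ∈ select) ⇔ P i
  ∈-select i = mk⇔ to from
    where
    to : i ∈ select → P i
    to i∈ with P? i | trans (sym (lookup∘tabulate (does ∘ P?) i)) ([]=⇒lookup i∈)
    ... | yes Pi | _ = Pi
    from : P i → i ∈ select
    from Pi = lookup⇒[]= i select
      (trans (lookup∘tabulate (does ∘ P?) i) (dec-true (P? i) Pi))

∣p∪q∣≤∣p∣+∣q∣ : ∀ {n} (p q : Subset n) → ∣ p ∪ q ∣ ≤ ∣ p ∣ + ∣ q ∣
∣p∪q∣≤∣p∣+∣q∣ []            []            = z≤n
∣p∪q∣≤∣p∣+∣q∣ (outside ∷ p) (outside ∷ q) = ∣p∪q∣≤∣p∣+∣q∣ p q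
∣p∪q∣≤∣p∣+∣q∣ (outside ∷ p) (inside  ∷ q) =
  ≤-trans (s≤s (∣p∪q∣≤∣p∣+∣q∣ p q)) (≤-reflexive (sym (+-suc ∣ p ∣ ∣ q ∣)))
∣p∪q∣≤∣p∣+∣q∣ (inside  ∷ p) (outside ∷ q) = s≤s (∣p∪q∣≤∣p∣+∣q∣ p q)
∣p∪q∣≤∣p∣+∣q∣ (inside  ∷ p) (inside  ∷ q) =
  s≤s (≤-trans (∣p∪q∣≤∣p∣+∣q∣ p q) (+-monoʳ-≤ ∣ p ∣ (n≤1+n ∣ q ∣)))

-- Deleting `j` from `r` leaves a cover, since `q` still contains `j`. Subadditivity then gives a
-- weak bound with `r - j`, and restoring `j` makes it strict.
cover⇒n<∣p∣+∣q∣+∣r∣ : ∀ {n} (p q r : Subset n) →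
  (∀ i → i ∈ p ⊎ i ∈ q ⊎ i ∈ r) → ∀ {j} → j ∈ q → j ∈ r →
  n < ∣ p ∣ + (∣ q ∣ + ∣ r ∣)
cover⇒n<∣p∣+∣q∣+∣r∣ {n} p q r cover {j} j∈q j∈r = begin-strict
  n                                ≡⟨ ∣⊤∣≡n n ⟨
  ∣ ⊤ {n} ∣                        ≤⟨ p⊆q⇒∣p∣≤∣q∣ {p = ⊤} (λ {i} _ → cover′ i) ⟩
  ∣ p ∪ (q ∪ (r - j)) ∣            ≤⟨ ∣p∪q∣≤∣p∣+∣q∣ p _ ⟩
  ∣ p ∣ + ∣ q ∪ (r - j) ∣          ≤⟨ +-monoʳ-≤ ∣ p ∣ (∣p∪q∣≤∣p∣+∣q∣ q _) ⟩
  ∣ p ∣ + (∣ q ∣ + ∣ r - j ∣)      <⟨ +-monoʳ-< ∣ p ∣ (+-monoʳ-< ∣ q ∣ (x∈p⇒∣p-x∣<∣p∣ j∈r)) ⟩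
  ∣ p ∣ + (∣ q ∣ + ∣ r ∣)          ∎
  where
  open ≤-Reasoning
  cover′ : ∀ i → i ∈ p ∪ (q ∪ (r - j))
  cover′ i with cover i | i Fin.≟ j
  ... | inj₁ i∈p        | _        = x∈p∪q⁺ (inj₁ i∈p)
  ... | inj₂ (inj₁ i∈q) | _        = x∈p∪q⁺ {p = p} (inj₂ (x∈p∪q⁺ (inj₁ i∈q)))
  ... | inj₂ (inj₂ i∈r) | yes refl = x∈p∪q⁺ {p = p} (inj₂ (x∈p∪q⁺ (inj₁ j∈q)))
  ... | inj₂ (inj₂ i∈r) | no i≢j   =
    x∈p∪q⁺ {p = p} (inj₂ (x∈p∪q⁺ {p = q} (inj₂ (x∈p∧x≢y⇒x∈p-y i∈r i≢j))))

3m<a+b+c⇒m< : ∀ {m} a b c → 3 * m < a + (b + c) → m < a ⊎ m < b ⊎ m < c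
3m<a+b+c⇒m< {m} a b c 3m< with a ≤? m | b ≤? m | c ≤? m
... | no a≰m  | _       | _       = inj₁ (≰⇒> a≰m)
... | yes _   | no b≰m  | _       = inj₂ (inj₁ (≰⇒> b≰m))
... | yes _   | yes _   | no c≰m  = inj₂ (inj₂ (≰⇒> c≰m))
... | yes a≤m | yes b≤m | yes c≤m = contradiction
  -- `3 * m` computes to `m + (m + (m + 0))`, so the last summand has to absorb a zero.
  (+-mono-≤ a≤m (+-mono-≤ b≤m (≤-trans c≤m (≤-reflexive (sym (+-identityʳ m))))))
  (<⇒≱ 3m<)

-- Graph criteria for property 𝒟 and for blow-ups.

cover⇒𝒟 : (G : Graph) → Decidable₂ (Adj G) →
  (∀ c → ∃₂ λ u v → Adj G c u × Adj G c v ×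
                    (∀ x → Adj G x c ⊎ Adj G x u ⊎ Adj G x v)) →
  ∀ k → 𝒟 k G
cover⇒𝒟 G adj? cover k (suc m) _ _ x = conclude
  (3m<a+b+c⇒m< (∣ nbrs c ∣) (∣ nbrs u ∣) (∣ nbrs v ∣)
    (cover⇒n<∣p∣+∣q∣+∣r∣ (nbrs c) (nbrs u) (nbrs v)
      (λ i → map ∈nbrs (map ∈nbrs ∈nbrs) (covers (x i)))
      {zero} (∈nbrs c~u) (∈nbrs c~v)))
  where
  -- Centring the cover at a member of the sequence is what yields the double count: its index lies
  -- in both `nbrs u` and `nbrs v`. The index `zero` exists because the sequence has length
  -- `3 * suc m`.
  c = x zero
  u = proj₁ (cover c)
  v = proj₁ (proj₂ (cover c))
  c~u = proj₁ (proj₂ (proj₂ (cover c)))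
  c~v = proj₁ (proj₂ (proj₂ (proj₂ (cover c))))
  covers = proj₂ (proj₂ (proj₂ (proj₂ (cover c))))
  nbrs : V G → Subset (3 * suc m)
  nbrs y = select (λ i → adj? (x i) y)
  ∈-nbrs : ∀ y i → (i ∈ nbrs y) ⇔ Adj G (x i) y
  ∈-nbrs y = ∈-select (λ i → adj? (x i) y)
  ∈nbrs : ∀ {y i} → Adj G (x i) y → i ∈ nbrs y
  ∈nbrs {y} {i} = Equivalence.from (∈-nbrs y i)
  conclude : suc m < ∣ nbrs c ∣ ⊎ suc m < ∣ nbrs u ∣ ⊎ suc m < ∣ nbrs v ∣ →
    ∃[ y ] Σ[ S ∈ Subset (3 * suc m) ]
      ((∀ i → (i ∈ S) ⇔ Adj G (x i) y) × suc (suc m) ≤ ∣ S ∣)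
  conclude (inj₁ m<)        = c , nbrs c , ∈-nbrs c , m<
  conclude (inj₂ (inj₁ m<)) = u , nbrs u , ∈-nbrs u , m<
  conclude (inj₂ (inj₂ m<)) = v , nbrs v , ∈-nbrs v , m<

-- Among the first n + 1 terms of `f`, two fall into the same one of the n blocks, and adjacency in
-- a blow-up depends only on blocks. The order `i < j` is kept because the later contradiction
-- depends on it.
blowUp⇒twins : (G H : Graph) → Finite (V H) → IsBlowUpOf G H → (f : ℕ → V G) →
  ∃₂ λ i j → i < j × (∀ z → Adj G (f i) z → Adj G (f j) z)
blowUp⇒twins G H (n , H↔Fin) (B , _ , iso) f = toℕ i , toℕ j , i<j , twins
  where
  open _≅_ iso
  block : V G → V H
  block = proj₁ ∘ Inverse.to bij
  ph = pigeonhole (n<1+n n) (Inverse.to H↔Fin ∘ block ∘ f ∘ toℕ)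
  i = proj₁ ph
  j = proj₁ (proj₂ ph)
  i<j = proj₁ (proj₂ (proj₂ ph))
  sameBlock : block (f (toℕ i)) ≡ block (f (toℕ j))
  sameBlock = Injection.injective (↔⇒↣ H↔Fin) (proj₂ (proj₂ (proj₂ ph)))
  twins : ∀ z → Adj G (f (toℕ i)) z → Adj G (f (toℕ j)) z
  twins z a = Equivalence.from (adj-iff _ z)
    (subst (λ b → Adj H b (block z)) sameBlock (Equivalence.to (adj-iff _ z) a))

-- With singleton blocks, a finite graph is a blow-up of a finite graph, namely itself. Hence not
-- being such a blow-up already forces infinitely many vertices.
blowUp-self : (G : Graph) → IsBlowUpOf G G
blowUp-self G = (λ _ → Unit.⊤) , (λ _ → Unit.tt) , record
  { bij     = mk↔ₛ′ (_, Unit.tt) proj₁ (λ _ → refl) (λ _ → refl)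
  ; adj-iff = λ _ _ → mk⇔ id id
  }

-- Arithmetic of the connection set modulo 3.

Step : ℤ → Set
Step d = ℤ.∣ d ∣ % 3 ≡ 1

step-cover-ℕ : ∀ n → n % 3 ≡ 1 ⊎ suc n % 3 ≡ 1 ⊎ suc (suc n) % 3 ≡ 1
step-cover-ℕ 0                   = inj₂ (inj₁ refl)
step-cover-ℕ 1                   = inj₁ refl
step-cover-ℕ 2                   = inj₂ (inj₂ refl)
-- `_% 3` discards three successors by computation, so the recursive call already has the required
-- type.
step-cover-ℕ (suc (suc (suc n))) = step-cover-ℕ n

∣1⊖[1+n]∣≡n : ∀ n → ℤ.∣ 1 ⊖ suc n ∣ ≡ n
∣1⊖[1+n]∣≡n n = trans (cong ℤ.∣_∣ (ℤ.[1+m]⊖[1+n]≡m⊖n 0 n)) (ℤ.∣m⊖n∣≡∣n⊖m∣ 0 n)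

-- For nonzero `d` the absolute values of the three integers are consecutive naturals, increasing
-- with `d` if it is positive and in the reverse order if it is negative. At 0 the integer 1 is a
-- step.
step-cover : ∀ d → Step d ⊎ Step (d ℤ.+ ℤ.1ℤ) ⊎ Step (d ℤ.- ℤ.1ℤ)
step-cover (+ 0)           = inj₂ (inj₁ refl)
step-cover (+ suc n) with step-cover-ℕ n
... | inj₁ p               = inj₂ (inj₂ p)
... | inj₂ (inj₁ p)        = inj₁ p
... | inj₂ (inj₂ p)        = inj₂ (inj₁ (subst Step (cong +_ (+-comm 1 (suc n))) p))
step-cover -[1+ n ] with step-cover-ℕ n
... | inj₁ p               = inj₂ (inj₁ (subst (λ k → k % 3 ≡ 1) (sym (∣1⊖[1+n]∣≡n n)) p))
... | inj₂ (inj₁ p)        = inj₁ p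
... | inj₂ (inj₂ p)        =
  inj₂ (inj₂ (subst (λ k → suc (suc k) % 3 ≡ 1) (sym (+-identityʳ n)) p))

-- This covers the sum of two steps of opposite signs. Three is removed from both arguments until
-- one of them is 1; the two remaining mixed cases are mirror images under the absolute value.
∣m⊖n∣%3≡0 : ∀ m n → m % 3 ≡ 1 → n % 3 ≡ 1 → ℤ.∣ m ⊖ n ∣ % 3 ≡ 0
∣m⊖n∣%3≡0 1 1 _ _ = refl
∣m⊖n∣%3≡0 1 (suc (suc (suc n))) p q = lemma n q
  where
  lemma : ∀ n → n % 3 ≡ 1 → suc (suc n) % 3 ≡ 0
  lemma 1                   _ = refl
  lemma (suc (suc (suc n))) q = lemma n q
∣m⊖n∣%3≡0 m@(suc (suc (suc _))) 1 p q =
  trans (cong (_% 3) (ℤ.∣m⊖n∣≡∣n⊖m∣ m 1)) (∣m⊖n∣%3≡0 1 m q p)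
∣m⊖n∣%3≡0 (suc (suc (suc m))) (suc (suc (suc n))) p q
  rewrite ℤ.[1+m]⊖[1+n]≡m⊖n (suc (suc m)) (suc (suc n))
        | ℤ.[1+m]⊖[1+n]≡m⊖n (suc m) (suc n)
        | ℤ.[1+m]⊖[1+n]≡m⊖n m n = ∣m⊖n∣%3≡0 m n p q

[m+n]%3≡2 : ∀ m n → m % 3 ≡ 1 → n % 3 ≡ 1 → (m + n) % 3 ≡ 2
[m+n]%3≡2 m n p q = trans (%-distribˡ-+ m n 3) (cong₂ (λ a b → (a + b) % 3) p q)

step-sum-free : ∀ i j → Step i → Step j → ¬ Step (i ℤ.+ j)
step-sum-free (+ m)    (+ n)    p q r = contradiction (trans (sym r) ([m+n]%3≡2 m n p q)) λ ()
step-sum-free (+ m)    -[1+ n ] p q r = contradiction (trans (sym r) (∣m⊖n∣%3≡0 m (suc n) p q)) λ ()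
step-sum-free -[1+ m ] (+ n)    p q r = contradiction (trans (sym r) (∣m⊖n∣%3≡0 n (suc m) q p)) λ ()
step-sum-free -[1+ m ] -[1+ n ] p q r = contradiction
  (trans (sym (subst (λ k → suc k % 3 ≡ 1) (sym (+-suc m n)) r)) ([m+n]%3≡2 (suc m) (suc n) p q))
  λ ()

-- The infinite Andrásfai graph and its properties.

andrásfai : Graph
andrásfai = record
  { V      = ℤ
  ; Adj    = λ x y → Step (x ℤ.- y)
  ; symm   = λ {x} {y} → subst (λ k → k % 3 ≡ 1) (ℤ.∣i-j∣≡∣j-i∣ x y)
  ; irrefl = λ x a → contradiction (trans (sym a) (cong (λ d → ℤ.∣ d ∣ % 3) (ℤ.+-inverseʳ x))) λ ()
  }

adj? : Decidable₂ (Adj andrásfai)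
adj? x y = ℤ.∣ x ℤ.- y ∣ % 3 ≟ 1

c~c-1 : ∀ c → Adj andrásfai c (c ℤ.- ℤ.1ℤ)
c~c-1 c = subst Step (identity c) refl
  where
  identity : ∀ c → ℤ.1ℤ ≡ c ℤ.- (c ℤ.- ℤ.1ℤ)
  identity = solve-∀

c~c+1 : ∀ c → Adj andrásfai c (c ℤ.+ ℤ.1ℤ)
c~c+1 c = subst Step (identity c) refl
  where
  identity : ∀ c → ℤ.-1ℤ ≡ c ℤ.- (c ℤ.+ ℤ.1ℤ)
  identity = solve-∀

andrásfai-cover : ∀ c x → Adj andrásfai x c ⊎
  Adj andrásfai x (c ℤ.- ℤ.1ℤ) ⊎ Adj andrásfai x (c ℤ.+ ℤ.1ℤ)
andrásfai-cover c x = map₂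
  -- The signs cross over: lowering the centre by 1 raises the difference by 1.
  (map (subst Step (identity₋ x c)) (subst Step (identity₊ x c)))
  (step-cover (x ℤ.- c))
  where
  identity₋ : ∀ x c → x ℤ.- c ℤ.+ ℤ.1ℤ ≡ x ℤ.- (c ℤ.- ℤ.1ℤ)
  identity₋ = solve-∀
  identity₊ : ∀ x c → x ℤ.- c ℤ.- ℤ.1ℤ ≡ x ℤ.- (c ℤ.+ ℤ.1ℤ)
  identity₊ = solve-∀

andrásfai-triangleFree : ¬ HasTriangle andrásfai
andrásfai-triangleFree (x , y , z , x~y , y~z , z~x) =
  step-sum-free (x ℤ.- y) (y ℤ.- z) x~y y~z
    -- Reversing the third edge presents it as the sum of the first two differences.
    (subst Step (identity x y z) (symm andrásfai {z} {x} z~x))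
  where
  identity : ∀ x y z → x ℤ.- z ≡ (x ℤ.- y) ℤ.+ (y ℤ.- z)
  identity = solve-∀

andrásfai-maximal : MaximalTriangleFree andrásfai
andrásfai-maximal = andrásfai-triangleFree , maximal
  where
  maximal : ∀ x y (x≢y : x ≢ y) → ¬ Adj andrásfai x y →
            HasTriangle (addEdge andrásfai x y x≢y)
  maximal x y x≢y x≁y with andrásfai-cover x y
  ... | inj₁ y~x       = contradiction (symm andrásfai {y} {x} y~x) x≁y
  -- Both possible centres `x - 1` and `x + 1` are neighbours of `x`, so the one adjacent to `y`
  -- closes a triangle over the new edge.
  ... | inj₂ (inj₁ y~) = x , y , x ℤ.- ℤ.1ℤ , inj₂ (inj₁ (refl , refl)) , inj₁ y~ ,
                         inj₁ (symm andrásfai {x} (c~c-1 x))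
  ... | inj₂ (inj₂ y~) = x , y , x ℤ.+ ℤ.1ℤ , inj₂ (inj₁ (refl , refl)) , inj₁ y~ ,
                         inj₁ (symm andrásfai {x} (c~c+1 x))

∣3j⊖[1+3i]∣%3≡2 : ∀ {i j} → i < j → ℤ.∣ j * 3 ⊖ suc (i * 3) ∣ % 3 ≡ 2
∣3j⊖[1+3i]∣%3≡2 {zero} {suc j} _
  rewrite ℤ.[1+m]⊖[1+n]≡m⊖n (suc (suc (j * 3))) 0 = step-2+ j
  where
  step-2+ : ∀ j → suc (suc (j * 3)) % 3 ≡ 2
  step-2+ zero    = refl
  step-2+ (suc j) = step-2+ j
∣3j⊖[1+3i]∣%3≡2 {suc i} {suc j} (s≤s i<j)
  rewrite ℤ.[1+m]⊖[1+n]≡m⊖n (suc (suc (j * 3))) (suc (suc (suc (i * 3))))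
        | ℤ.[1+m]⊖[1+n]≡m⊖n (suc (j * 3)) (suc (suc (i * 3)))
        | ℤ.[1+m]⊖[1+n]≡m⊖n (j * 3) (suc (i * 3)) = ∣3j⊖[1+3i]∣%3≡2 i<j

-- The vertex 3i + 1 separates the two: it is adjacent to 3i, but its distance to 3j is 3(j - i) -
-- 1, of residue 2. For j < i the distance would be 3(i - j) + 1, a step, so this witness depends on
-- the order.
multiplesOf3-noTwins : ∀ {i j} → i < j →
  ¬ (∀ z → Adj andrásfai (+ (i * 3)) z → Adj andrásfai (+ (j * 3)) z)
multiplesOf3-noTwins {i} {j} i<j twins =
  contradiction (trans (sym (∣3j⊖[1+3i]∣%3≡2 i<j)) (subst Step difference adjacent)) λ ()
  where
  adjacent : Adj andrásfai (+ (j * 3)) (+ (i * 3) ℤ.+ ℤ.1ℤ)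
  adjacent = twins (+ (i * 3) ℤ.+ ℤ.1ℤ) (c~c+1 (+ (i * 3)))
  difference : + (j * 3) ℤ.- (+ (i * 3) ℤ.+ ℤ.1ℤ) ≡ j * 3 ⊖ suc (i * 3)
  difference = trans (cong (λ k → + (j * 3) ℤ.- + k) (+-comm (i * 3) 1))
                     (ℤ.[+m]-[+n]≡m⊖n (j * 3) (suc (i * 3)))

andrásfai-notBlowUp : ¬ (Σ[ H ∈ Graph ] (Finite (V H) × IsBlowUpOf andrásfai H))
andrásfai-notBlowUp (H , finite , blowUp)
  with _ , _ , i<j , twins ← blowUp⇒twins andrásfai H finite blowUp (λ i → + (i * 3)) =
  multiplesOf3-noTwins i<j twins

theorem5p2 : Σ[ G ∈ Graph ]
    (Infinite (V G) ×
    MaximalTriangleFree G ×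
    (∀ (k : ℕ) → 1 ≤ k → 𝒟 k G) ×
    ¬ (Σ[ H ∈ Graph ] (Finite (V H) × IsBlowUpOf G H)))
theorem5p2 = andrásfai
  , (λ finite → andrásfai-notBlowUp (andrásfai , finite , blowUp-self andrásfai))
  , andrásfai-maximal
  , (λ k _ → cover⇒𝒟 andrásfai adj?
      (λ c → c ℤ.- ℤ.1ℤ , c ℤ.+ ℤ.1ℤ , c~c-1 c , c~c+1 c , andrásfai-cover c) k)
  , andrásfai-notBlowUp
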